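{- Let $U=\{1,\dots,n\}$ with distance function $d$, and suppose $p_i=p$ for all $i\in U$, where $0<p<1$. Let $\tau$ be an integer with $2\le\tau\le n$. Then the B$\tau$I (best-$\tau$ items) algorithm is a $(1-p^{\tau-1}-p^{n-\tau}+p^n)$-approximation for MaxOHP. That is, if $O$ is any ordering output by the algorithm, then $$\mathcal{H}(O)\ \ge\ \big(1-p^{\tau-1}-p^{n-\tau}+p^n\big)\,\max_{O'}\mathcal{H}(O'),$$ where the maximum is over all orderings $O'$ of $U$.
   Context: The distance function $d:U\times U\to\mathbb{R}_{\ge0}$ is symmetric with $d(i,i)=0$. For an ordering $O=(\pi(1),\dots,\pi(n))$ of $U$ given by a permutation $\pi$, let $O_k=(\pi(1),\dots,\pi(k))$ and $p_{O_k}=\prod_{t=1}^kp_{\pi(t)}$. The ordered Hamiltonian path objective is $\mathcal{H}(O)=\sum_{i=1}^{n-1}W_{O_i}\,d(\pi(i),\pi(i+1))$ with $W_{O_i}=\sum_{j=i+1}^np_{O_j}$ (so $W_{O_i}=\sum_{j=i+1}^np^j$ when all $p_i=p$). MaxOHP asks for an ordering of $U$ maximizing $\mathcal{H}$. The B$\tau$I algorithm (uniform case) chooses a sequence of $\tau$ distinct items $(\pi(1),\dots,\pi(\tau))$ maximizing $\hat{\mathcal{H}}(O_\tau)=\sum_{i=1}^{\tau-1}\frac{p^{i+1}}{1-p}d(\pi(i),\pi(i+1))$ over all sequences of $\tau$ distinct items of $U$, and then extends it to an ordering of all of $U$ by appending the remaining items in an arbitrary order. -}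

module Defs where

open import Level using (Level; _⊔_) renaming (suc to lsuc)
open import Algebra.Bundles using (CommutativeRing)
open import Algebra.Core using (Op₁; Op₂)
import Algebra.Properties.Monoid.Sum as MonoidSum
import Algebra.Properties.Semiring.Exp as SemiringExp
open import Data.Fin.Base using (Fin; toℕ; inject₁; inject≤) renaming (suc to fsuc)
open import Data.Fin.Permutation using (Permutation′; _⟨$⟩ʳ_)
open import Data.List.Base using (List; foldr; map; take; tabulate)
open import Data.Nat.Base as ℕ using (ℕ; zero; suc; _∸_)
open import Data.Product.Base using (_×_; ∃-syntax)
open import Function.Definitions using (Injective)
open import Relation.Binary.Core using (Rel; _Preserves_⟶_)
open import Relation.Binary.PropositionalEquality.Core using (_≡_)
open import Relation.Binary.Structures using (IsTotalOrder)
open import Relation.Nullary.Negation.Core using (¬_)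

-- The standard library has no real numbers, so the scalars range over an
-- arbitrary (totally) ordered field, of which ℝ is an instance.

record OrderedField (c ℓ₁ ℓ₂ : Level) : Set (lsuc (c ⊔ ℓ₁ ⊔ ℓ₂)) where
  infix  4 _≤_ _<_
  infixl 7 _/_
  infix  8 _⁻¹
  field
    commutativeRing : CommutativeRing c ℓ₁

  open CommutativeRing commutativeRing public

  -- The inverse is total; nothing is assumed about the value of 0# ⁻¹.
  field
    _⁻¹          : Op₁ Carrier
    _≤_          : Rel Carrier ℓ₂
    ⁻¹-cong      : _⁻¹ Preserves _≈_ ⟶ _≈_
    *-inverseʳ   : ∀ {x} → ¬ (x ≈ 0#) → x * x ⁻¹ ≈ 1#
    0≉1          : ¬ (0# ≈ 1#)
    isTotalOrder : IsTotalOrder _≈_ _≤_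
    +-monoˡ-≤    : ∀ {x y} z → x ≤ y → x + z ≤ y + z
    *-nonNeg     : ∀ {x y} → 0# ≤ x → 0# ≤ y → 0# ≤ x * y

  _<_ : Rel Carrier (ℓ₁ ⊔ ℓ₂)
  x < y = x ≤ y × ¬ (x ≈ y)

  _/_ : Op₂ Carrier
  x / y = x * y ⁻¹

  open SemiringExp semiring public using (_^_)
  open MonoidSum +-monoid public using (sum)

-- An ordering O of U = Fin n is a permutation π of Fin n; the k-th item
-- (k = 1, …, n) of the ordering is π ⟨$⟩ʳ (k - 1).
Ordering : ℕ → Set
Ordering n = Permutation′ n

initialItems : ∀ {n} → Ordering n → ℕ → List (Fin n)
initialItems O k = take k (tabulate (O ⟨$⟩ʳ_))

module _ {c ℓ₁ ℓ₂} (F : OrderedField c ℓ₁ ℓ₂) where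
  open OrderedField F

  record IsDistance {n : ℕ} (d : Fin n → Fin n → Carrier) : Set (ℓ₁ ⊔ ℓ₂) where
    field
      nonNeg    : ∀ i j → 0# ≤ d i j
      symmetric : ∀ i j → d i j ≈ d j i
      zeroDiag  : ∀ i → d i i ≈ 0#

  IsMaximum : ∀ {a} {A : Set a} → (A → Carrier) → Carrier → Set (a ⊔ ℓ₁ ⊔ ℓ₂)
  IsMaximum f M = (∃[ x ] f x ≈ M) × (∀ x → f x ≤ M)

  -- Σ_{i=1}^{m-1} w i · d (x i) (x (i+1)) for a sequence x of m items; the
  -- weights w are indexed from 1, whereas x is indexed by Fin m, from 0.
  pathSum : ∀ {m n} → (Fin n → Fin n → Carrier) →
            (ℕ → Carrier) → (Fin m → Fin n) → Carrier
  pathSum {zero}  d w x = 0#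
  pathSum {suc m} d w x =
    sum {m} (λ i → w (suc (toℕ i)) * d (x (inject₁ i)) (x (fsuc i)))

  prefixProb : ∀ {n} → (Fin n → Carrier) → Ordering n → ℕ → Carrier
  prefixProb P O k = foldr _*_ 1# (map P (initialItems O k))

  -- W_{O_i} = Σ_{j=i+1}^n p_{O_j}, with j = i + 1 + toℕ k for k : Fin (n ∸ i).
  W : ∀ {n} → (Fin n → Carrier) → Ordering n → ℕ → Carrier
  W {n} P O i = sum {n ∸ i} (λ k → prefixProb P O (i ℕ.+ suc (toℕ k)))

  H : ∀ {n} → (Fin n → Fin n → Carrier) → (Fin n → Carrier) →
      Ordering n → Carrier
  H d P O = pathSum d (W P O) (O ⟨$⟩ʳ_)

  Ĥ : ∀ {n τ} → (Fin n → Fin n → Carrier) → Carrier →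
      (Fin τ → Fin n) → Carrier
  Ĥ d p s = pathSum d (λ i → p ^ (i ℕ.+ 1) / (1# - p)) s

  -- The possible outputs of the algorithm: s is the chosen sequence of τ items
  -- (ties broken arbitrarily), and O is any ordering that begins with s.
  record IsBτIOutput {n τ : ℕ} (τ≤n : τ ℕ.≤ n)
                     (d : Fin n → Fin n → Carrier) (p : Carrier)
                     (O : Ordering n) : Set (c ⊔ ℓ₁ ⊔ ℓ₂) where
    field
      s        : Fin τ → Fin n
      distinct : Injective _≡_ _≡_ s
      best     : ∀ (s′ : Fin τ → Fin n) → Injective _≡_ _≡_ s′ →
                 Ĥ d p s′ ≤ Ĥ d p s
      extends  : ∀ i → O ⟨$⟩ʳ (inject≤ i τ≤n) ≡ s i

{-# OPTIONS --safe #-}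

-- Cut the edges of an ordering O′ into blocks of τ − 1 consecutive edges, the
-- items being continued cyclically so that the last block is complete.  Each
-- block is a sequence of τ distinct items, so with the weights p^{i+1}/(1 − p)
-- the k-th block contributes at most p^{k(τ−1)} Ĥ(s), where s is the sequence
-- chosen by the algorithm; summing the geometric series gives
-- (1 − p^{τ−1}) H(O′) ≤ Ĥ(s).  Conversely, truncating the weights at n loses at
-- most a factor 1 − p^{n−τ} on the first τ − 1 edges, so that
-- (1 − p^{n−τ}) Ĥ(s) ≤ H(O).

module Submission where

open import Defs
open import Data.Fin.Base using (Fin; toℕ; inject₁; inject≤; punchIn) renaming (zero to fzero; suc to fsuc)
open import Data.Fin.Permutation using (Permutation′; _⟨$⟩ʳ_; id; insert; remove; insert-remove)
  renaming (_≈_ to _≗ₚ_)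
open import Data.Fin.Properties using (toℕ-injective; toℕ-inject₁; toℕ-inject≤; toℕ-fromℕ<; toℕ<n)
open import Data.List.Base using ([]; _∷_; foldr; length; map; take)
open import Data.List.Properties using (length-take; length-tabulate; tabulate-cong)
open import Data.Nat.Base as ℕ using (ℕ; zero; suc; _∸_; z≤n; s≤s; NonZero)
open import Data.Nat.DivMod using (_%_; _mod_; %-distribˡ-+; [m+kn]%n≡m%n; m<n⇒m%n≡m)
import Data.Nat.Properties as ℕ
open import Data.Nat.Tactic.RingSolver using (solve-∀)
open import Data.Product.Base using (_×_; _,_; proj₁; proj₂; ∃-syntax)
open import Data.Sum.Base using (inj₁; inj₂)
open import Function.Base using (_∘_)
open import Function.Bundles using (Injection)
open import Function.Definitions using (Injective)
open import Function.Properties.Inverse using (↔⇒↣)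
open import Relation.Binary.Bundles using (Poset)
import Relation.Binary.PropositionalEquality as ≡
open ≡ using (_≡_)
open import Relation.Binary.Structures using (IsTotalOrder)
open import Relation.Nullary.Negation using (¬_; contradiction)

-- Cyclic indexing of an ordering, and congruence of `insert`.

%-+-injective : ∀ n .{{_ : NonZero n}} a {i j} → i ℕ.< n → j ℕ.< n →
                (a ℕ.+ i) % n ≡ (a ℕ.+ j) % n → i ≡ j
%-+-injective (suc n) a {i} {j} i<n j<n eq = begin
  i                                                        ≡⟨ shift i i<n ⟩
  ((a ℕ.+ i) % suc n ℕ.+ (a ℕ.* n) % suc n) % suc n        ≡⟨ ≡.cong (λ k → (k ℕ.+ (a ℕ.* n) % suc n) % suc n) eq ⟩
  ((a ℕ.+ j) % suc n ℕ.+ (a ℕ.* n) % suc n) % suc n        ≡⟨ shift j j<n ⟨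
  j                                                        ∎
  where
  open ≡.≡-Reasoning
  rearrange : ∀ n a k → k ℕ.+ a ℕ.* suc n ≡ (a ℕ.+ k) ℕ.+ a ℕ.* n
  rearrange = solve-∀
  -- This undoes the shift by `a` without subtraction: since the modulus is `suc n`, adding `a * n`
  -- to `a + k` gives `k + a * suc n`, which has residue `k`. So the residue of `a + k` determines
  -- `k`.
  shift : ∀ k → k ℕ.< suc n → k ≡ ((a ℕ.+ k) % suc n ℕ.+ (a ℕ.* n) % suc n) % suc n
  shift k k<n = begin
    k                                                  ≡⟨ m<n⇒m%n≡m k<n ⟨
    k % suc n                                          ≡⟨ [m+kn]%n≡m%n k a (suc n) ⟨
    (k ℕ.+ a ℕ.* suc n) % suc n                        ≡⟨ ≡.cong (_% suc n) (rearrange n a k) ⟩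
    ((a ℕ.+ k) ℕ.+ a ℕ.* n) % suc n                    ≡⟨ %-distribˡ-+ (a ℕ.+ k) (a ℕ.* n) (suc n) ⟩
    ((a ℕ.+ k) % suc n ℕ.+ (a ℕ.* n) % suc n) % suc n  ∎

toℕ-mod : ∀ {n} .{{_ : NonZero n}} (i : Fin n) → toℕ i mod n ≡ i
toℕ-mod i = toℕ-injective (≡.trans (toℕ-fromℕ< _) (m<n⇒m%n≡m (toℕ<n i)))

-- Indexing by all of ℕ lets a block start anywhere and run past the end of the ordering without
-- side conditions.
cyclic : ∀ {n} .{{_ : NonZero n}} → Ordering n → ℕ → Fin n
cyclic {n} O k = O ⟨$⟩ʳ (k mod n)

cyclic-toℕ : ∀ {n} .{{_ : NonZero n}} (O : Ordering n) i → O ⟨$⟩ʳ i ≡ cyclic O (toℕ i)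
cyclic-toℕ O i = ≡.cong (O ⟨$⟩ʳ_) (≡.sym (toℕ-mod i))

-- At most `n` consecutive positions have pairwise different residues, and a permutation keeps them
-- apart. This is what makes every window an admissible competitor of the algorithm's sequence, even
-- one that wraps around.
cyclic-window-injective : ∀ {m n} .{{_ : NonZero n}} → m ℕ.≤ n → (O : Ordering n) → ∀ a →
                          Injective _≡_ _≡_ (λ (i : Fin m) → cyclic O (a ℕ.+ toℕ i))
cyclic-window-injective {n = n} m≤n O a {i} {j} eq = toℕ-injective
  (%-+-injective n a (ℕ.<-≤-trans (toℕ<n i) m≤n) (ℕ.<-≤-trans (toℕ<n j) m≤n)
    (≡.trans (≡.sym (toℕ-fromℕ< _))
      (≡.trans (≡.cong toℕ (Injection.injective (↔⇒↣ O) eq)) (toℕ-fromℕ< _))))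

insert-cong : ∀ {n} j {π ρ : Permutation′ n} → π ≗ₚ ρ → insert fzero j π ≗ₚ insert fzero j ρ
insert-cong j π≗ρ fzero    = ≡.refl
insert-cong j π≗ρ (fsuc i) = ≡.cong (punchIn j) (π≗ρ i)

-- Arithmetic of ordered fields.

module OrderedFieldProperties {c ℓ₁ ℓ₂} (F : OrderedField c ℓ₁ ℓ₂) where
  open OrderedField F
  open IsTotalOrder isTotalOrder public
    using (isPartialOrder; total; antisym)
    renaming (refl to ≤-refl; reflexive to ≤-reflexive; trans to ≤-trans)
  open import Algebra.Properties.Ring ring using (-‿distribˡ-*; -‿distribʳ-*; -‿involutive; x[y-z]≈xy-xz)
  open import Algebra.Properties.Monoid.Sum +-monoid using (sum-cong-≋)
  open import Algebra.Solver.Ring.NaturalCoefficients.Default commutativeSemiring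

  poset : Poset c ℓ₁ ℓ₂
  poset = record { isPartialOrder = isPartialOrder }

  open import Relation.Binary.Reasoning.PartialOrder poset

  [x-y]+y≈x : ∀ x y → (x - y) + y ≈ x
  [x-y]+y≈x x y = begin-equality
    (x - y) + y    ≈⟨ +-assoc x (- y) y ⟩
    x + (- y + y)  ≈⟨ +-congˡ (-‿inverseˡ y) ⟩
    x + 0#         ≈⟨ +-identityʳ x ⟩
    x              ∎

  x≤y⇒0≤y-x : ∀ {x y} → x ≤ y → 0# ≤ y - x
  x≤y⇒0≤y-x {x} {y} x≤y = begin
    0#     ≈⟨ -‿inverseʳ x ⟨
    x - x  ≤⟨ +-monoˡ-≤ (- x) x≤y ⟩
    y - x  ∎

  0≤y-x⇒x≤y : ∀ {x y} → 0# ≤ y - x → x ≤ y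
  0≤y-x⇒x≤y {x} {y} 0≤y-x = begin
    x            ≈⟨ +-identityˡ x ⟨
    0# + x       ≤⟨ +-monoˡ-≤ x 0≤y-x ⟩
    (y - x) + x  ≈⟨ [x-y]+y≈x y x ⟩
    y            ∎

  +-monoʳ-≤ : ∀ {x y} z → x ≤ y → z + x ≤ z + y
  +-monoʳ-≤ {x} {y} z x≤y = begin
    z + x  ≈⟨ +-comm z x ⟩
    x + z  ≤⟨ +-monoˡ-≤ z x≤y ⟩
    y + z  ≈⟨ +-comm y z ⟩
    z + y  ∎

  +-mono-≤ : ∀ {w x y z} → w ≤ x → y ≤ z → w + y ≤ x + z
  +-mono-≤ w≤x y≤z = ≤-trans (+-monoˡ-≤ _ w≤x) (+-monoʳ-≤ _ y≤z)

  +-nonNeg : ∀ {x y} → 0# ≤ x → 0# ≤ y → 0# ≤ x + y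
  +-nonNeg 0≤x 0≤y = ≤-trans (≤-reflexive (sym (+-identityˡ 0#))) (+-mono-≤ 0≤x 0≤y)

  x≤x+y : ∀ {x y} → 0# ≤ y → x ≤ x + y
  x≤x+y 0≤y = ≤-trans (≤-reflexive (sym (+-identityʳ _))) (+-monoʳ-≤ _ 0≤y)

  +-cancelʳ-≤ : ∀ {x y} z → x + z ≤ y + z → x ≤ y
  +-cancelʳ-≤ {x} {y} z x+z≤y+z = begin
    x              ≈⟨ undo x ⟨
    (x + z) - z    ≤⟨ +-monoˡ-≤ (- z) x+z≤y+z ⟩
    (y + z) - z    ≈⟨ undo y ⟩
    y              ∎
    where
    undo : ∀ w → (w + z) - z ≈ w
    undo w = trans (+-assoc w z (- z)) (trans (+-congˡ (-‿inverseʳ z)) (+-identityʳ w))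

  *-monoˡ-≤ : ∀ {x y} z → 0# ≤ z → x ≤ y → z * x ≤ z * y
  *-monoˡ-≤ {x} {y} z 0≤z x≤y = 0≤y-x⇒x≤y (begin
    0#             ≤⟨ *-nonNeg 0≤z (x≤y⇒0≤y-x x≤y) ⟩
    z * (y - x)    ≈⟨ x[y-z]≈xy-xz z y x ⟩
    z * y - z * x  ∎)

  *-monoʳ-≤ : ∀ {x y} z → 0# ≤ z → x ≤ y → x * z ≤ y * z
  *-monoʳ-≤ {x} {y} z 0≤z x≤y = begin
    x * z  ≈⟨ *-comm x z ⟩
    z * x  ≤⟨ *-monoˡ-≤ z 0≤z x≤y ⟩
    z * y  ≈⟨ *-comm z y ⟩
    y * z  ∎

  positive⇒≉0 : ∀ {x} → 0# < x → ¬ (x ≈ 0#)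
  positive⇒≉0 (_ , 0≉x) x≈0 = 0≉x (sym x≈0)

  x<y⇒0<y-x : ∀ {x y} → x < y → 0# < y - x
  x<y⇒0<y-x {x} {y} (x≤y , x≉y) = x≤y⇒0≤y-x x≤y , λ 0≈y-x → x≉y (begin-equality
    x            ≈⟨ +-identityˡ x ⟨
    0# + x       ≈⟨ +-congʳ 0≈y-x ⟩
    (y - x) + x  ≈⟨ [x-y]+y≈x y x ⟩
    y            ∎)

  -- Otherwise multiplying `x ⁻¹ ≤ 0#` by `x` would give `1# ≤ 0#`. The premise `0# ≤ 1#` is later
  -- supplied by 0 < p < 1.
  ⁻¹-nonNeg : 0# ≤ 1# → ∀ {x} → 0# < x → 0# ≤ x ⁻¹
  ⁻¹-nonNeg 0≤1 {x} 0<x with total 0# (x ⁻¹)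
  ... | inj₁ 0≤x⁻¹ = 0≤x⁻¹
  ... | inj₂ x⁻¹≤0 = contradiction (antisym 0≤1 (begin
    1#         ≈⟨ *-inverseʳ (positive⇒≉0 0<x) ⟨
    x * x ⁻¹   ≤⟨ *-monoˡ-≤ x (proj₁ 0<x) x⁻¹≤0 ⟩
    x * 0#     ≈⟨ zeroʳ x ⟩
    0#         ∎)) 0≉1

  -- Finite sums with summands indexed by ℕ, easy to split and shift.

  Σ< : ℕ → (ℕ → Carrier) → Carrier
  Σ< m g = sum {m} (λ i → g (toℕ i))

  Σ<-cong : ∀ m {f g} → (∀ i → i ℕ.< m → f i ≈ g i) → Σ< m f ≈ Σ< m g
  Σ<-cong m f≈g = sum-cong-≋ (λ i → f≈g (toℕ i) (toℕ<n i))

  Σ<-mono-≤ : ∀ m {f g} → (∀ i → i ℕ.< m → f i ≤ g i) → Σ< m f ≤ Σ< m g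
  Σ<-mono-≤ zero    f≤g = ≤-refl
  Σ<-mono-≤ (suc m) f≤g =
    +-mono-≤ (f≤g 0 (s≤s z≤n)) (Σ<-mono-≤ m (λ i i<m → f≤g (suc i) (s≤s i<m)))

  Σ<-nonNeg : ∀ m {g} → (∀ i → i ℕ.< m → 0# ≤ g i) → 0# ≤ Σ< m g
  Σ<-nonNeg zero    0≤g = ≤-refl
  Σ<-nonNeg (suc m) 0≤g = +-nonNeg (0≤g 0 (s≤s z≤n)) (Σ<-nonNeg m (λ i i<m → 0≤g (suc i) (s≤s i<m)))

  Σ<-+ : ∀ m k g → Σ< (m ℕ.+ k) g ≈ Σ< m g + Σ< k (λ i → g (m ℕ.+ i))
  Σ<-+ zero    k g = sym (+-identityˡ _)
  Σ<-+ (suc m) k g = trans (+-congˡ (Σ<-+ m k (g ∘ suc))) (sym (+-assoc _ _ _))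

  Σ<-monoˡ-≤ : ∀ {m k g} → m ℕ.≤ k → (∀ i → i ℕ.< k → 0# ≤ g i) → Σ< m g ≤ Σ< k g
  Σ<-monoˡ-≤ {m} {k} {g} m≤k 0≤g = begin
    Σ< m g                                   ≤⟨ x≤x+y (Σ<-nonNeg (k ∸ m) (λ i i< → 0≤g (m ℕ.+ i) (bound i i<))) ⟩
    Σ< m g + Σ< (k ∸ m) (λ i → g (m ℕ.+ i))  ≈⟨ Σ<-+ m (k ∸ m) g ⟨
    Σ< (m ℕ.+ (k ∸ m)) g                     ≡⟨ ≡.cong (λ l → Σ< l g) (ℕ.m+[n∸m]≡n m≤k) ⟩
    Σ< k g                                   ∎
    where
    bound : ∀ i → i ℕ.< k ∸ m → m ℕ.+ i ℕ.< k
    bound i i< = ≡.subst (m ℕ.+ i ℕ.<_) (ℕ.m+[n∸m]≡n m≤k) (ℕ.+-monoʳ-< m i<)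

  -- The series is multiplied out, so no division occurs. Only the recurrence of `g` is assumed, so
  -- that the induction hypothesis applies to the tail `g ∘ suc`.
  geometric-sum : ∀ {p g} → (∀ k → g (suc k) ≈ p * g k) → ∀ m →
                  (1# - p) * Σ< m g + g m ≈ g 0
  geometric-sum {p} {g} ratio zero    = trans (+-congʳ (zeroʳ _)) (+-identityˡ _)
  geometric-sum {p} {g} ratio (suc m) = begin-equality
    t * (g 0 + Σ< m (g ∘ suc)) + g (suc m)       ≈⟨ solve 4 (λ t x y z → t :* (x :+ y) :+ z := t :* x :+ (t :* y :+ z)) refl t _ _ _ ⟩
    t * g 0 + (t * Σ< m (g ∘ suc) + g (suc m))   ≈⟨ +-congˡ (geometric-sum (ratio ∘ suc) m) ⟩
    t * g 0 + g 1                                ≈⟨ +-congˡ (ratio 0) ⟩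
    t * g 0 + p * g 0                            ≈⟨ distribʳ _ _ _ ⟨
    (t + p) * g 0                                ≈⟨ *-congʳ ([x-y]+y≈x 1# p) ⟩
    1# * g 0                                     ≈⟨ *-identityˡ _ ⟩
    g 0                                          ∎
    where t = 1# - p

  -- Existence of maxima over finite sets and over permutations.

  maximum-Fin : ∀ n (f : Fin (suc n) → Carrier) → ∃[ j ] (∀ i → f i ≤ f j)
  maximum-Fin zero    f = fzero , λ { fzero → ≤-refl }
  maximum-Fin (suc n) f with maximum-Fin n (f ∘ fsuc)
  ... | j , max with total (f fzero) (f (fsuc j))
  ...   | inj₁ f0≤fj = fsuc j , λ { fzero → f0≤fj ; (fsuc i) → max i }
  ...   | inj₂ fj≤f0 = fzero , λ { fzero → ≤-refl ; (fsuc i) → ≤-trans (max i) fj≤f0 }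

  -- A permutation is an image `j` of the first element together with a permutation of the rest:
  -- maximise over the rest for each `j` by recursion, then over `j`. Reassembling a permutation
  -- from these data recovers it only pointwise, hence the congruence assumption on `f`.
  maximum-Permutation : ∀ n (f : Permutation′ n → Carrier) → (∀ {π ρ} → π ≗ₚ ρ → f π ≈ f ρ) →
                        ∃[ ρ ] (∀ π → f π ≤ f ρ)
  maximum-Permutation zero    f f-cong = id , λ π → ≤-reflexive (f-cong {π} {id} λ ())
  maximum-Permutation (suc n) f f-cong = insert fzero (proj₁ best) (arg (proj₁ best)) , λ π → begin
    f π                                                       ≈⟨ f-cong (insert-remove fzero π) ⟨
    f (insert fzero (π ⟨$⟩ʳ fzero) (remove fzero π))          ≤⟨ proj₂ (rest (π ⟨$⟩ʳ fzero)) _ ⟩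
    f (insert fzero (π ⟨$⟩ʳ fzero) (arg (π ⟨$⟩ʳ fzero)))      ≤⟨ proj₂ best (π ⟨$⟩ʳ fzero) ⟩
    f (insert fzero (proj₁ best) (arg (proj₁ best)))          ∎
    where
    rest : ∀ j → ∃[ ρ ] (∀ π → f (insert fzero j π) ≤ f (insert fzero j ρ))
    rest j = maximum-Permutation n (λ π → f (insert fzero j π))
               (λ {π} {ρ} π≗ρ → f-cong (insert-cong j {π} {ρ} π≗ρ))
    arg : Fin (suc n) → Permutation′ n
    arg j = proj₁ (rest j)
    best = maximum-Fin n (λ j → f (insert fzero j (arg j)))

  -- The two losses in the proof multiply to (1 - q)(1 - r) = 1 - q - r + qr; a smaller last term
  -- only weakens the ratio.
  approximation-ratio : ∀ {q r z} → z ≤ q * r → ((1# - q) - r) + z ≤ (1# - q) * (1# - r)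
  approximation-ratio {q} {r} {z} z≤qr = begin
    ((1# - q) - r) + z          ≤⟨ +-monoʳ-≤ _ z≤qr ⟩
    ((1# - q) - r) + q * r      ≈⟨ +-congˡ -q*-r≈q*r ⟨
    -- The solver has natural coefficients only, so `- q` and `- r` serve as its variables.
    ((1# - q) - r) + - q * - r  ≈⟨ solve 2 (λ x y → con 1 :+ x :+ y :+ x :* y := (con 1 :+ x) :* (con 1 :+ y)) refl (- q) (- r) ⟩
    (1# - q) * (1# - r)         ∎
    where
    -q*-r≈q*r : - q * - r ≈ q * r
    -q*-r≈q*r = begin-equality
      - q * - r      ≈⟨ -‿distribˡ-* q (- r) ⟨
      - (q * - r)    ≈⟨ -‿cong (-‿distribʳ-* q r) ⟨
      - - (q * r)    ≈⟨ -‿involutive (q * r) ⟩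
      q * r          ∎

-- Powers of `p` and the weights built from them.

module GeometricWeights {c ℓ₁ ℓ₂} (F : OrderedField c ℓ₁ ℓ₂)
                        {p : OrderedField.Carrier F}
                        (0<p : OrderedField._<_ F (OrderedField.0# F) p)
                        (p<1 : OrderedField._<_ F p (OrderedField.1# F)) where
  open OrderedField F
  open OrderedFieldProperties F
  open import Algebra.Properties.Semiring.Exp semiring using (^-homo-*; ^-congʳ)
  open import Algebra.Properties.Semiring.Sum semiring using (*-distribˡ-sum)
  open import Algebra.Solver.Ring.NaturalCoefficients.Default commutativeSemiring
  open import Relation.Binary.Reasoning.PartialOrder poset

  0≤1 : 0# ≤ 1#
  0≤1 = ≤-trans (proj₁ 0<p) (proj₁ p<1)

  0≤p^ : ∀ k → 0# ≤ p ^ k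
  0≤p^ zero    = 0≤1
  0≤p^ (suc k) = *-nonNeg (proj₁ 0<p) (0≤p^ k)

  p^≤1 : ∀ k → p ^ k ≤ 1#
  p^≤1 zero    = ≤-refl
  p^≤1 (suc k) = begin
    p * p ^ k  ≤⟨ *-monoˡ-≤ p (proj₁ 0<p) (p^≤1 k) ⟩
    p * 1#     ≈⟨ *-identityʳ p ⟩
    p          ≤⟨ proj₁ p<1 ⟩
    1#         ∎

  p^-antitone : ∀ {m k} → m ℕ.≤ k → p ^ k ≤ p ^ m
  p^-antitone {m} {k} m≤k = begin
    p ^ k                ≡⟨ ≡.cong (p ^_) (ℕ.m+[n∸m]≡n m≤k) ⟨
    p ^ (m ℕ.+ (k ∸ m))  ≈⟨ ^-homo-* p m (k ∸ m) ⟩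
    p ^ m * p ^ (k ∸ m)  ≤⟨ *-monoˡ-≤ _ (0≤p^ m) (p^≤1 (k ∸ m)) ⟩
    p ^ m * 1#           ≈⟨ *-identityʳ _ ⟩
    p ^ m                ∎

  0≤1-p^ : ∀ k → 0# ≤ 1# - p ^ k
  0≤1-p^ k = x≤y⇒0≤y-x (p^≤1 k)

  [1-p]*[1-p]⁻¹≈1 : (1# - p) * (1# - p) ⁻¹ ≈ 1#
  [1-p]*[1-p]⁻¹≈1 = *-inverseʳ (positive⇒≉0 (x<y⇒0<y-x p<1))

  0≤[1-p]⁻¹ : 0# ≤ (1# - p) ⁻¹
  0≤[1-p]⁻¹ = ⁻¹-nonNeg 0≤1 (x<y⇒0<y-x p<1)

  -- Over the reals this is the infinite tail p^(i+1) + p^(i+2) + ..., of which `W` keeps the terms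
  -- up to p^n.
  ŵ : ℕ → Carrier
  ŵ i = p ^ (i ℕ.+ 1) / (1# - p)

  0≤ŵ : ∀ i → 0# ≤ ŵ i
  0≤ŵ i = *-nonNeg (0≤p^ (i ℕ.+ 1)) 0≤[1-p]⁻¹

  -- Infinite tails are self-similar under shifts. The truncated weights `W` are not, which is why
  -- blocks are compared with `ŵ`.
  ŵ-+ : ∀ m i → ŵ (suc (m ℕ.+ i)) ≈ p ^ m * ŵ (suc i)
  ŵ-+ m i = begin-equality
    p ^ (suc (m ℕ.+ i) ℕ.+ 1) / (1# - p)    ≡⟨ ≡.cong (λ k → p ^ k / (1# - p)) (reassoc m i) ⟩
    p ^ (m ℕ.+ (suc i ℕ.+ 1)) / (1# - p)    ≈⟨ *-congʳ (^-homo-* p m (suc i ℕ.+ 1)) ⟩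
    (p ^ m * p ^ (suc i ℕ.+ 1)) / (1# - p)  ≈⟨ *-assoc _ _ _ ⟩
    p ^ m * ŵ (suc i)                       ∎
    where
    reassoc : ∀ m i → suc (m ℕ.+ i) ℕ.+ 1 ≡ m ℕ.+ (suc i ℕ.+ 1)
    reassoc = solve-∀

  -- The weights restart at the beginning of the block while the edges start at `a`; for the edges
  -- of an ordering this is `Ĥ` of the window at `a`.
  discounted : (ℕ → Carrier) → ℕ → ℕ → Carrier
  discounted D m a = Σ< m (λ i → ŵ (suc i) * D (a ℕ.+ i))

  discounted-+ : ∀ D m k a → discounted D (m ℕ.+ k) a ≈
                             discounted D m a + p ^ m * discounted D k (a ℕ.+ m)
  discounted-+ D m k a = begin-equality
    discounted D (m ℕ.+ k) a
      ≈⟨ Σ<-+ m k (λ i → ŵ (suc i) * D (a ℕ.+ i)) ⟩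
    discounted D m a + Σ< k (λ i → ŵ (suc (m ℕ.+ i)) * D (a ℕ.+ (m ℕ.+ i)))
      ≈⟨ +-congˡ (Σ<-cong k (λ i _ → shift i)) ⟩
    discounted D m a + Σ< k (λ i → p ^ m * (ŵ (suc i) * D ((a ℕ.+ m) ℕ.+ i)))
      ≈⟨ +-congˡ (*-distribˡ-sum {k} (p ^ m) _) ⟨
    discounted D m a + p ^ m * discounted D k (a ℕ.+ m)  ∎
    where
    shift : ∀ i → ŵ (suc (m ℕ.+ i)) * D (a ℕ.+ (m ℕ.+ i)) ≈
                  p ^ m * (ŵ (suc i) * D ((a ℕ.+ m) ℕ.+ i))
    shift i = begin-equality
      ŵ (suc (m ℕ.+ i)) * D (a ℕ.+ (m ℕ.+ i))      ≈⟨ *-congʳ (ŵ-+ m i) ⟩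
      (p ^ m * ŵ (suc i)) * D (a ℕ.+ (m ℕ.+ i))    ≈⟨ *-assoc _ _ _ ⟩
      p ^ m * (ŵ (suc i) * D (a ℕ.+ (m ℕ.+ i)))    ≡⟨ ≡.cong (λ k → p ^ m * (ŵ (suc i) * D k)) (ℕ.+-assoc a m i) ⟨
      p ^ m * (ŵ (suc i) * D ((a ℕ.+ m) ℕ.+ i))    ∎

  -- With q = p^m, the first block contributes at most (1 - q)B and the others, by induction from
  -- `a + m`, at most qB; together this is B. The bound is thus independent of the number of blocks.
  discounted-blocks : ∀ {D B m} → 0# ≤ B → (∀ a → discounted D m a ≤ B) →
                      ∀ j a → (1# - p ^ m) * discounted D (j ℕ.* m) a ≤ B
  discounted-blocks 0≤B block≤B zero    a = ≤-trans (≤-reflexive (zeroʳ _)) 0≤B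
  discounted-blocks {D} {B} {m} 0≤B block≤B (suc j) a = begin
    e * discounted D (m ℕ.+ j ℕ.* m) a
      ≈⟨ *-congˡ (discounted-+ D m (j ℕ.* m) a) ⟩
    e * (discounted D m a + q * rest)
      ≈⟨ solve 4 (λ e x q y → e :* (x :+ q :* y) := e :* x :+ q :* (e :* y)) refl e _ q _ ⟩
    e * discounted D m a + q * (e * rest)
      ≤⟨ +-mono-≤ (*-monoˡ-≤ e (0≤1-p^ m) (block≤B a))
                  (*-monoˡ-≤ q (0≤p^ m) (discounted-blocks {D} 0≤B block≤B j (a ℕ.+ m))) ⟩
    e * B + q * B
      ≈⟨ distribʳ B e q ⟨
    (e + q) * B
      ≈⟨ *-congʳ ([x-y]+y≈x 1# q) ⟩
    1# * B
      ≈⟨ *-identityˡ B ⟩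
    B ∎
    where
    q e rest : Carrier
    q    = p ^ m
    e    = 1# - q
    rest = discounted D (j ℕ.* m) (a ℕ.+ m)

  -- The truncated weights `W` under uniform probabilities.

  module _ {n : ℕ} {P : Fin n → Carrier} (P≈p : ∀ i → P i ≈ p) where

    product-map-P : ∀ xs → foldr _*_ 1# (map P xs) ≈ p ^ length xs
    product-map-P []       = refl
    product-map-P (x ∷ xs) = *-cong (P≈p x) (product-map-P xs)

    prefixProb-uniform : ∀ O {k} → k ℕ.≤ n → prefixProb F P O k ≈ p ^ k
    prefixProb-uniform O {k} k≤n = begin-equality
      prefixProb F P O k             ≈⟨ product-map-P (initialItems O k) ⟩
      p ^ length (initialItems O k)  ≡⟨ ≡.cong (p ^_) length-initialItems ⟩
      p ^ k                          ∎
      where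
      length-initialItems : length (initialItems O k) ≡ k
      length-initialItems =
        ≡.trans (length-take k _)
          (≡.trans (≡.cong (k ℕ.⊓_) (length-tabulate (O ⟨$⟩ʳ_))) (ℕ.m≤n⇒m⊓n≡m k≤n))

    -- The infinite tail after `i` splits at `n` into the terms of `W` and the tail after `n`.
    W-closed : ∀ O {i} → i ℕ.≤ n → ŵ i ≈ W F P O i + ŵ n
    W-closed O {i} i≤n = begin-equality
      p ^ (i ℕ.+ 1) * u                             ≈⟨ *-congʳ (geometric-sum {p} {g} ratio (n ∸ i)) ⟨
      (t * Σ< (n ∸ i) g + g (n ∸ i)) * u            ≈⟨ solve 4 (λ t s x u → (t :* s :+ x) :* u := (t :* u) :* s :+ x :* u) refl t _ _ u ⟩
      (t * u) * Σ< (n ∸ i) g + g (n ∸ i) * u        ≈⟨ +-congʳ (trans (*-congʳ [1-p]*[1-p]⁻¹≈1) (*-identityˡ _)) ⟩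
      Σ< (n ∸ i) g + g (n ∸ i) * u                  ≈⟨ +-cong (Σ<-cong (n ∸ i) (λ k k< → sym (prefixProb-uniform O (bound k k<))))
                                                               (*-congʳ (^-congʳ p last)) ⟩
      W F P O i + p ^ (n ℕ.+ 1) * u                 ∎
      where
      t u : Carrier
      t = 1# - p
      u = t ⁻¹
      -- The first `n ∸ i` terms run from p^(i+1) to p^n; the next one, p^(n+1), is the remainder
      -- left by `geometric-sum`.
      g : ℕ → Carrier
      g k = p ^ (i ℕ.+ suc k)
      ratio : ∀ k → g (suc k) ≈ p * g k
      ratio k = ^-congʳ p (ℕ.+-suc i (suc k))
      bound : ∀ k → k ℕ.< n ∸ i → i ℕ.+ suc k ℕ.≤ n
      bound k k< = ≡.subst (i ℕ.+ suc k ℕ.≤_) (ℕ.m+[n∸m]≡n i≤n) (ℕ.+-monoʳ-≤ i k<)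
      last : i ℕ.+ suc (n ∸ i) ≡ n ℕ.+ 1
      last = ≡.trans (ℕ.+-suc i (n ∸ i))
               (≡.trans (≡.cong suc (ℕ.m+[n∸m]≡n i≤n)) (ℕ.+-comm 1 n))

    W≤ŵ : ∀ O {i} → i ℕ.≤ n → W F P O i ≤ ŵ i
    W≤ŵ O i≤n = ≤-trans (x≤x+y (0≤ŵ n)) (≤-reflexive (sym (W-closed O i≤n)))

    0≤W : ∀ O {i} → i ℕ.≤ n → 0# ≤ W F P O i
    0≤W O {i} i≤n = +-cancelʳ-≤ (ŵ n) (begin
      0# + ŵ n         ≈⟨ +-identityˡ _ ⟩
      ŵ n              ≤⟨ *-monoʳ-≤ _ 0≤[1-p]⁻¹ (p^-antitone (ℕ.+-monoˡ-≤ 1 i≤n)) ⟩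
      ŵ i              ≈⟨ W-closed O i≤n ⟩
      W F P O i + ŵ n  ∎)

    -- Truncation loses `ŵ n`, which is p^(n-i) times `ŵ i` and hence at most p^(n-k) times it. One
    -- factor therefore serves all indices up to `k`.
    [1-p^]ŵ≤W : ∀ O {i k} → i ℕ.≤ k → k ℕ.≤ n → (1# - p ^ (n ∸ k)) * ŵ i ≤ W F P O i
    [1-p^]ŵ≤W O {i} {k} i≤k k≤n = +-cancelʳ-≤ (r * ŵ i) (begin
      (1# - r) * ŵ i + r * ŵ i  ≈⟨ distribʳ _ _ _ ⟨
      ((1# - r) + r) * ŵ i      ≈⟨ *-congʳ ([x-y]+y≈x 1# r) ⟩
      1# * ŵ i                  ≈⟨ *-identityˡ _ ⟩
      ŵ i                       ≈⟨ W-closed O (ℕ.≤-trans i≤k k≤n) ⟩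
      W F P O i + ŵ n           ≤⟨ +-monoʳ-≤ _ (*-monoʳ-≤ _ 0≤[1-p]⁻¹ (p^-antitone exponent)) ⟩
      W F P O i + p ^ ((n ∸ k) ℕ.+ (i ℕ.+ 1)) / (1# - p)
                                ≈⟨ +-congˡ (trans (*-congʳ (^-homo-* p (n ∸ k) (i ℕ.+ 1))) (*-assoc _ _ _)) ⟩
      W F P O i + r * ŵ i       ∎)
      where
      r : Carrier
      r = p ^ (n ∸ k)
      exponent : (n ∸ k) ℕ.+ (i ℕ.+ 1) ℕ.≤ n ℕ.+ 1
      exponent = ≡.subst (ℕ._≤ n ℕ.+ 1) (ℕ.+-assoc (n ∸ k) i 1)
        (ℕ.+-monoˡ-≤ 1 (≡.subst ((n ∸ k) ℕ.+ i ℕ.≤_) (ℕ.m∸n+n≡m k≤n) (ℕ.+-monoʳ-≤ (n ∸ k) i≤k)))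

-- Comparison of `H` with `Ĥ` for `suc n` items, that is `n` edges.

module Approximation {c ℓ₁ ℓ₂} (F : OrderedField c ℓ₁ ℓ₂)
                     {n : ℕ} {d : Fin (suc n) → Fin (suc n) → OrderedField.Carrier F}
                     (isDistance : IsDistance F d)
                     {P : Fin (suc n) → OrderedField.Carrier F} {p : OrderedField.Carrier F}
                     (P≈p : ∀ i → OrderedField._≈_ F (P i) p)
                     (0<p : OrderedField._<_ F (OrderedField.0# F) p)
                     (p<1 : OrderedField._<_ F p (OrderedField.1# F)) where
  open OrderedField F
  open IsDistance isDistance
  open OrderedFieldProperties F
  open GeometricWeights F 0<p p<1
  open import Algebra.Properties.Semiring.Sum semiring using (*-distribˡ-sum)
  open import Algebra.Properties.Monoid.Sum +-monoid using (sum-cong-≋; sum-cong-≗)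
  open import Relation.Binary.Reasoning.PartialOrder poset

  -- The path uses the indices below `n`; index `n` closes the cycle from the last item to the
  -- first.
  edge : Ordering (suc n) → ℕ → Carrier
  edge O k = d (cyclic O k) (cyclic O (suc k))

  0≤edge : ∀ O k → 0# ≤ edge O k
  0≤edge O k = nonNeg _ _

  pathSum-Σ< : ∀ {m} w (s : Fin (suc m) → Fin (suc n)) x → (∀ i → s i ≡ x (toℕ i)) →
               pathSum F d w s ≈ Σ< m (λ i → w (suc i) * d (x i) (x (suc i)))
  pathSum-Σ< {m} w s x s≡x = sum-cong-≋ {m} (λ i → *-congˡ (reflexive (≡.cong₂ d
    (≡.trans (s≡x (inject₁ i)) (≡.cong x (toℕ-inject₁ i))) (s≡x (fsuc i)))))

  H-Σ< : ∀ O → H F d P O ≈ Σ< n (λ i → W F P O (suc i) * edge O i)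
  H-Σ< O = pathSum-Σ< (W F P O) (O ⟨$⟩ʳ_) (cyclic O) (cyclic-toℕ O)

  H-cong : ∀ {π ρ} → π ≗ₚ ρ → H F d P π ≈ H F d P ρ
  H-cong {π} {ρ} π≗ρ = sum-cong-≋ {n} (λ i → *-cong (reflexive (W-cong (suc (toℕ i))))
    (reflexive (≡.cong₂ d (π≗ρ (inject₁ i)) (π≗ρ (fsuc i)))))
    where
    W-cong : ∀ i → W F P π i ≡ W F P ρ i
    W-cong i = sum-cong-≗ {suc n ∸ i} (λ k →
      ≡.cong (λ xs → foldr _*_ 1# (map P (take (i ℕ.+ suc (toℕ k)) xs))) (tabulate-cong π≗ρ))

  0≤W*edge : ∀ O i → i ℕ.< n → 0# ≤ W F P O (suc i) * edge O i
  0≤W*edge O i i<n = *-nonNeg (0≤W P≈p O (ℕ.m≤n⇒m≤1+n i<n)) (0≤edge O i)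

  0≤H : ∀ O → 0# ≤ H F d P O
  0≤H O = ≤-trans (Σ<-nonNeg n (0≤W*edge O)) (≤-reflexive (sym (H-Σ< O)))

  H≤discounted : ∀ O → H F d P O ≤ discounted (edge O) n 0
  H≤discounted O = ≤-trans (≤-reflexive (H-Σ< O))
    (Σ<-mono-≤ n (λ i i<n → *-monoʳ-≤ {W F P O (suc i)} {ŵ (suc i)} (edge O i) (0≤edge O i) (W≤ŵ P≈p O (ℕ.m≤n⇒m≤1+n i<n))))

  -- Upper bound for every ordering, with `m` standing for τ - 1.

  module _ {m : ℕ} (1≤m : 1 ℕ.≤ m) (m≤n : m ℕ.≤ n)
           {s : Fin (suc m) → Fin (suc n)}
           (best : ∀ (s′ : Fin (suc m) → Fin (suc n)) → Injective _≡_ _≡_ s′ → Ĥ F d p s′ ≤ Ĥ F d p s) where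

    -- The block is the value of a window of `suc m` cyclically consecutive items, which are
    -- distinct, so the optimality of `s` applies.
    block≤Ĥ : ∀ O a → discounted (edge O) m a ≤ Ĥ F d p s
    block≤Ĥ O a = begin
      discounted (edge O) m a    ≡⟨⟩
      Σ< m (λ i → ŵ (suc i) * d (cyclic O (a ℕ.+ i)) (cyclic O (suc (a ℕ.+ i))))
        ≈⟨ Σ<-cong m (λ i _ → *-congˡ {ŵ (suc i)} (reflexive (≡.cong (d (cyclic O (a ℕ.+ i)) ∘ cyclic O) (≡.sym (ℕ.+-suc a i))))) ⟩
      Σ< m (λ i → ŵ (suc i) * d (cyclic O (a ℕ.+ i)) (cyclic O (a ℕ.+ suc i)))
        ≈⟨ pathSum-Σ< ŵ window (λ i → cyclic O (a ℕ.+ i)) (λ _ → ≡.refl) ⟨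
      Ĥ F d p window             ≤⟨ best window (cyclic-window-injective (s≤s m≤n) O a) ⟩
      Ĥ F d p s                  ∎
      where
      window : Fin (suc m) → Fin (suc n)
      window i = cyclic O (a ℕ.+ toℕ i)

    0≤Ĥ : 0# ≤ Ĥ F d p s
    0≤Ĥ = ≤-trans (Σ<-nonNeg m (λ i _ → *-nonNeg (0≤ŵ (suc i)) (0≤edge id i))) (block≤Ĥ id 0)

    [1-p^]H≤Ĥ : ∀ O → (1# - p ^ m) * H F d P O ≤ Ĥ F d p s
    [1-p^]H≤Ĥ O = begin
      (1# - p ^ m) * H F d P O
        ≤⟨ *-monoˡ-≤ _ (0≤1-p^ m) (H≤discounted O) ⟩
      (1# - p ^ m) * discounted (edge O) n 0
        -- As blocks are nonempty, `n` of them cover all `n` edges. The surplus edges are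
        -- nonnegative and the block bound ignores the count, so n/m need not be rounded.
        ≤⟨ *-monoˡ-≤ _ (0≤1-p^ m) (Σ<-monoˡ-≤ n≤n*m (λ i _ → *-nonNeg (0≤ŵ (suc i)) (0≤edge O i))) ⟩
      (1# - p ^ m) * discounted (edge O) (n ℕ.* m) 0
        ≤⟨ discounted-blocks {edge O} 0≤Ĥ (block≤Ĥ O) n 0 ⟩
      Ĥ F d p s ∎
      where
      n≤n*m : n ℕ.≤ n ℕ.* m
      n≤n*m = ≡.subst (ℕ._≤ n ℕ.* m) (ℕ.*-identityʳ n) (ℕ.*-monoʳ-≤ n 1≤m)

  -- The ordering starts with `s`, so both objectives share the first `m` edges, where only the
  -- weights differ; the arbitrary remainder contributes a nonnegative amount.
  [1-p^]Ĥ≤H : ∀ {m} (m≤n : m ℕ.≤ n) O {s} → (∀ i → O ⟨$⟩ʳ (inject≤ i (s≤s m≤n)) ≡ s i) →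
              (1# - p ^ (n ∸ m)) * Ĥ F d p s ≤ H F d P O
  [1-p^]Ĥ≤H {m} m≤n O {s} extends = begin
    f * Ĥ F d p s
      ≈⟨ *-congˡ (pathSum-Σ< ŵ s (cyclic O) s≡cyclic) ⟩
    f * Σ< m (λ i → ŵ (suc i) * edge O i)
      ≈⟨ *-distribˡ-sum {m} f _ ⟩
    Σ< m (λ i → f * (ŵ (suc i) * edge O i))
      ≈⟨ Σ<-cong m (λ i _ → sym (*-assoc f (ŵ (suc i)) (edge O i))) ⟩
    Σ< m (λ i → (f * ŵ (suc i)) * edge O i)
      -- The weight bound is taken with `k = suc m`, that is τ, although the indices reach only `m`;
      -- its exponent `suc n ∸ suc m` reduces to `n ∸ m`.
      ≤⟨ Σ<-mono-≤ m (λ i i<m → *-monoʳ-≤ {f * ŵ (suc i)} {W F P O (suc i)} (edge O i) (0≤edge O i)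
                                  ([1-p^]ŵ≤W P≈p O (s≤s (ℕ.<⇒≤ i<m)) (s≤s m≤n))) ⟩
    Σ< m w
      ≤⟨ Σ<-monoˡ-≤ m≤n (0≤W*edge O) ⟩
    Σ< n w
      ≈⟨ H-Σ< O ⟨
    H F d P O ∎
    where
    f : Carrier
    f = 1# - p ^ (n ∸ m)
    w : ℕ → Carrier
    w i = W F P O (suc i) * edge O i
    s≡cyclic : ∀ i → s i ≡ cyclic O (toℕ i)
    s≡cyclic i = ≡.trans (≡.sym (extends i))
      (≡.trans (cyclic-toℕ O _) (≡.cong (cyclic O) (toℕ-inject≤ i (s≤s m≤n))))

theorem6p1 : ∀ {c ℓ₁ ℓ₂} (F : OrderedField c ℓ₁ ℓ₂) (let open OrderedField F)
    (n : ℕ) (d : Fin n → Fin n → Carrier) → IsDistance F d →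
    (P : Fin n → Carrier) (p : Carrier) → (∀ i → P i ≈ p) →
    0# < p → p < 1# →
    (τ : ℕ) → 2 ℕ.≤ τ → (τ≤n : τ ℕ.≤ n) →
    (O : Ordering n) → IsBτIOutput F τ≤n d p O →
    ∃[ M ] (IsMaximum F (H F d P) M ×
    (((1# - p ^ (τ ∸ 1)) - p ^ (n ∸ τ)) + p ^ n) * M ≤ H F d P O)
theorem6p1 F (suc n) d isDistance P p P≈p 0<p p<1 (suc m) (s≤s 1≤m) (s≤s m≤n) O output =
  -- Here τ is `suc m` and there are `suc n` items, so `q` is p^(τ-1) and `r` has the number of
  -- items minus τ as exponent.
  M , ((O* , refl) , proj₂ maximum) , (begin
    (((1# - q) - r) + p ^ suc n) * M  ≤⟨ *-monoʳ-≤ M (0≤H O*) (approximation-ratio p^[1+n]≤q*r) ⟩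
    ((1# - q) * (1# - r)) * M         ≈⟨ solve 3 (λ e f x → (e :* f) :* x := f :* (e :* x)) refl _ _ M ⟩
    (1# - r) * ((1# - q) * M)         ≤⟨ *-monoˡ-≤ _ (0≤1-p^ (n ∸ m)) ([1-p^]H≤Ĥ 1≤m m≤n {s} best O*) ⟩
    (1# - r) * Ĥ F d p s              ≤⟨ [1-p^]Ĥ≤H m≤n O {s} extends ⟩
    H F d P O                         ∎)
  where
  open OrderedField F
  open OrderedFieldProperties F
  open GeometricWeights F 0<p p<1
  open Approximation F isDistance P≈p 0<p p<1
  open IsBτIOutput output
  open import Algebra.Properties.Semiring.Exp semiring using (^-homo-*)
  open import Algebra.Solver.Ring.NaturalCoefficients.Default commutativeSemiring
  open import Relation.Binary.Reasoning.PartialOrder poset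

  maximum = maximum-Permutation (suc n) (H F d P) (λ {π} {ρ} → H-cong {π} {ρ})
  O* = proj₁ maximum
  M q r : Carrier
  M = H F d P O*
  q = p ^ m
  r = p ^ (n ∸ m)

  -- The exponents of `q` and `r` add up to one less than the number of items, so the claimed ratio
  -- lies slightly below (1 - q)(1 - r).
  p^[1+n]≤q*r : p ^ suc n ≤ q * r
  p^[1+n]≤q*r = begin
    p ^ suc n            ≤⟨ p^-antitone (ℕ.n≤1+n n) ⟩
    p ^ n                ≡⟨ ≡.cong (p ^_) (ℕ.m+[n∸m]≡n m≤n) ⟨
    p ^ (m ℕ.+ (n ∸ m))  ≈⟨ ^-homo-* p m (n ∸ m) ⟩
    q * r                ∎
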